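{- There exists a finite simple connected graph $G$ with a vertex $v \in V(G)$ such that $\gamma_{cg}(G|v) = \gamma_{cg}(G) + 1$.
   Context: The connected domination game on a graph $G$ is played by two players, Dominator and Staller, who alternately select vertices. A vertex $w$ is a legal move if (a) its closed neighborhood $N[w]$ contains at least one vertex that is not yet dominated, i.e. not in the union of the closed neighborhoods of the previously selected vertices, and (b) unless it is the first move, $w$ is adjacent to at least one already selected vertex. Dominator wants to finish (dominate all vertices) in as few moves as possible, Staller wants to prolong the game. $\gamma_{cg}(G)$ is the number of moves under optimal play when Dominator moves first (D-game). For $v\in V(G)$, $G|v$ denotes $G$ with $v$ predominated: the same game is played, except that $v$ is considered already dominated from the start (it may still be selected if this is a legal move; predomination does not make $v$ a selected vertex). $\gamma_{cg}(G|v)$ is the number of moves in the D-game on $G|v$ under optimal play. If a position is reached in which some vertex is not dominated but there is no legal move, the game is regarded as never finishing, i.e. as an infinite number of moves (the worst outcome for Dominator). -}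

module Defs where

open import Data.Fin.Base using (Fin)
open import Data.Fin.Properties using (_≟_; any?; all?)
open import Data.Fin.Subset using (Subset; _∈_; _∪_; ⁅_⁆; ⊥; Empty)
open import Data.Fin.Subset.Properties using (_∈?_; nonempty?)
open import Data.List.Base using (List; []; _∷_; allFin; filter; map)
open import Data.Nat.Base using (ℕ; zero; suc; _≤_)
open import Data.Nat.Properties using (≤-isTotalOrder)
open import Data.Product.Base using (∃-syntax; _×_)
open import Data.Sum.Base using (_⊎_)
open import Level using (0ℓ)
open import Relation.Binary.Bundles using (TotalOrder)
open import Relation.Binary.Construct.Add.Supremum.NonStrict _≤_ using (≤⁺-isTotalOrder-≡)
open import Relation.Binary.Construct.Closure.ReflexiveTransitive using (Star)
open import Relation.Binary.Core using (Rel)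
open import Relation.Binary.Definitions using (Decidable; Irreflexive; Symmetric)
open import Relation.Binary.PropositionalEquality.Core using (_≡_)
open import Relation.Nullary.Construct.Add.Supremum using (_⁺; [_]; ⊤⁺)
open import Relation.Nullary.Decidable.Core using (yes; no; ¬?; _×-dec_; _⊎-dec_)
open import Relation.Nullary.Negation.Core using (¬_)
open import Relation.Unary using () renaming (Decidable to Decidable₁)

record Graph (n : ℕ) : Set₁ where
  infix 4 _~_ _~?_
  field
    _~_    : Rel (Fin n) 0ℓ
    _~?_   : Decidable _~_
    sym    : Symmetric _~_
    irrefl : Irreflexive _≡_ _~_

  -- u ∈N[ w ] : u lies in the closed neighbourhood of w
  infix 4 _∈N[_] _∈N[_]?
  _∈N[_] : Rel (Fin n) 0ℓ
  u ∈N[ w ] = u ≡ w ⊎ w ~ u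

  _∈N[_]? : Decidable _∈N[_]
  u ∈N[ w ]? = (u ≟ w) ⊎-dec (w ~? u)

Connected : ∀ {n} → Graph n → Set
Connected {n} G = ∀ (u v : Fin n) → Star (Graph._~_ G) u v

-- Numbers of moves; ⊤⁺ stands for a game that never finishes.
ℕ∞ : Set
ℕ∞ = ℕ ⁺

suc∞ : ℕ∞ → ℕ∞
suc∞ [ k ] = [ suc k ]
suc∞ ⊤⁺    = ⊤⁺

ℕ∞-totalOrder : TotalOrder 0ℓ 0ℓ 0ℓ
ℕ∞-totalOrder = record { isTotalOrder = ≤⁺-isTotalOrder-≡ ≤-isTotalOrder }

open import Data.List.Extrema ℕ∞-totalOrder using (min; max)

data Player : Set where
  dominator staller : Player

opponent : Player → Player
opponent dominator = staller
opponent staller   = dominator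

-- Number of moves still to be made, given the player to move and the values
-- of the positions reachable by a legal move. Having no legal move is the
-- outcome ⊤⁺ for either player.
optimal : Player → List ℕ∞ → ℕ∞
optimal _         []       = ⊤⁺
optimal dominator (x ∷ xs) = suc∞ (min x xs)
optimal staller   (x ∷ xs) = suc∞ (max x xs)

-- The game on G in which the vertices of P are predominated. A position is
-- the set S of vertices selected so far.
module Game {n : ℕ} (G : Graph n) (P : Subset n) where
  open Graph G

  Dominated : Subset n → Fin n → Set
  Dominated S u = u ∈ P ⊎ (∃[ s ] s ∈ S × u ∈N[ s ])

  dominated? : ∀ S → Decidable₁ (Dominated S)
  dominated? S u = (u ∈? P) ⊎-dec any? (λ s → (s ∈? S) ×-dec (u ∈N[ s ]?))

  Finished : Subset n → Set
  Finished S = ∀ u → Dominated S u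

  Legal : Subset n → Fin n → Set
  Legal S w = (∃[ u ] u ∈N[ w ] × ¬ Dominated S u)
            × (Empty S ⊎ (∃[ s ] s ∈ S × s ~ w))

  legal? : ∀ S → Decidable₁ (Legal S)
  legal? S w = any? (λ u → (u ∈N[ w ]?) ×-dec ¬? (dominated? S u))
         ×-dec (¬? (nonempty? S) ⊎-dec any? (λ s → (s ∈? S) ×-dec (s ~? w)))

  legalMoves : Subset n → List (Fin n)
  legalMoves S = filter (legal? S) (allFin n)

  -- value f p S is the number of further moves under optimal play from S with
  -- p to move, where f bounds the number of further moves. A legal move
  -- always dominates a new vertex, so starting from f = n the clause for f = 0
  -- is only reached in finished positions.
  value : ℕ → Player → Subset n → ℕ∞
  value f p S with all? (dominated? S)
  value _       _ _ | yes _ = [ 0 ]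
  value zero    _ _ | no _  = ⊤⁺
  value (suc f) p S | no _  =
    optimal p (map (λ w → value f (opponent p) (S ∪ ⁅ w ⁆)) (legalMoves S))

  γ : ℕ∞
  γ = value n dominator ⊥

γcg[_] : ∀ {n} → Graph n → ℕ∞
γcg[ G ] = Game.γ G ⊥

γcg[_∣_] : ∀ {n} → Graph n → Fin n → ℕ∞
γcg[ G ∣ v ] = Game.γ G ⁅ v ⁆

{-# OPTIONS --safe #-}

-- The graph is a diamond 1, 2, 3, 4 (1 and 2 are the vertices of degree three)
-- with a leaf 0 attached to 1 and a path 5, 6, 7 attached to 4. Since 1 and 6
-- are adjacent to leaves and 4 and 5 are cut vertices between them, the
-- selected set must contain 1, 4, 5 and 6, so either game takes at least four
-- moves. On G, Dominator opens with 1, and then 4, 5, 6 are the only legal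
-- moves. On G ∣ 5 this opening is fatal: after it no vertex adjacent to 1
-- dominates anything new, while 6 and 7 are still undominated. Hence 4 has to be
-- selected before 1, and Staller can arrange to waste a move on 2, whose only new
-- vertex is 3; Dominator attains 5 by opening with 4.
module Submission where

open import Defs
open import Data.Bool.Base using (Bool; true; false; T; _∨_)
open import Data.Bool.Properties using (∨-comm; T?)
open import Data.Fin.Base using (Fin)
open import Data.Fin.Patterns
open import Data.Nat.Base using (ℕ; suc)
open import Data.Product.Base using (Σ-syntax; ∃-syntax; _×_; _,_)
open import Relation.Binary.Construct.Closure.ReflexiveTransitive using (Star; ε; _◅_; _◅◅_; reverse)
open import Relation.Binary.PropositionalEquality.Core using (_≡_; refl; subst)
open import Relation.Nullary.Construct.Add.Supremum using ([_])

-- Each edge is listed once, from its smaller end, and symmetrised by `∨` below. Boolean values let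
-- adjacency of concrete vertices be decided by computation.
edge : Fin 8 → Fin 8 → Bool
edge 0F 1F = true
edge 1F 2F = true
edge 1F 3F = true
edge 1F 4F = true
edge 2F 3F = true
edge 2F 4F = true
edge 4F 5F = true
edge 5F 6F = true
edge 6F 7F = true
edge _  _  = false

tailedDiamond : Graph 8
tailedDiamond = record
  { _~_    = λ u v → T (edge u v ∨ edge v u)
  ; _~?_   = λ u v → T? (edge u v ∨ edge v u)
  ; sym    = λ {u} {v} → subst T (∨-comm (edge u v) (edge v u))
  ; irrefl = λ { {0F} refl () ; {1F} refl () ; {2F} refl () ; {3F} refl ()
               ; {4F} refl () ; {5F} refl () ; {6F} refl () ; {7F} refl () }
  }

open Graph tailedDiamond using (_~_; sym)

-- For concrete u and v the implicit adjacency proof has type ⊤ and is solved by η.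
via : ∀ v {u w} {u~v : u ~ v} → Star _~_ v w → Star _~_ u w
via v {u~v = u~v} = u~v ◅_

-- With 1 as a hub, one walk per vertex replaces one per pair.
walk-to-1 : ∀ u → Star _~_ u 1F
walk-to-1 0F = via 1F ε
walk-to-1 1F = ε
walk-to-1 2F = via 1F ε
walk-to-1 3F = via 1F ε
walk-to-1 4F = via 1F ε
walk-to-1 5F = via 4F (via 1F ε)
walk-to-1 6F = via 5F (via 4F (via 1F ε))
walk-to-1 7F = via 6F (via 5F (via 4F (via 1F ε)))

tailedDiamond-connected : Connected tailedDiamond
tailedDiamond-connected u v =
  walk-to-1 u ◅◅ reverse (λ {x} {y} → sym {x} {y}) (walk-to-1 v)

proposition5p1 : ∃[ n ] Σ[ G ∈ Graph n ] Σ[ v ∈ Fin n ] Connected G ×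
    (∃[ k ] γcg[ G ] ≡ [ k ] × γcg[ G ∣ v ] ≡ [ suc k ])
-- Each `refl` has the type checker evaluate a whole game tree: to 4 on the graph itself, to 5 with
-- vertex 5 predominated.
proposition5p1 = 8 , tailedDiamond , 5F , tailedDiamond-connected , 4 , refl , refl
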